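{- Let $k \geq 0$ be an integer. (i) If $k \leq 6$, then $K_{m,m+k}$ is stable for all integers $m \geq 1$. (ii) If $k \geq 7$, then there exists an integer $N(k)$ such that $K_{m,m+k}$ is stable for all integers $m > N(k)$.
   Context: For a simple graph $G$, the independence polynomial is $i(G,x)=\sum_{k=0}^{\alpha(G)} i_k(G)x^k$, where $i_k(G)$ is the number of independent sets of size $k$ in $G$ (with $i_0(G)=1$) and $\alpha(G)$ is the independence number. A graph $G$ is called stable if every root $z$ of $i(G,x)$ satisfies $\mathrm{Re}(z)\leq 0$. $K_{a,b}$ denotes the complete bipartite graph with parts of sizes $a$ and $b$; its independence polynomial is $(1+x)^a+(1+x)^b-1$. -}

module Defs where

open import Algebra.Bundles using (RawSemiring)
import Algebra.Definitions.RawSemiring as RawSemiringDefinitions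
open import Data.Empty using (⊥)
open import Data.Fin.Base using (Fin; toℕ; splitAt)
import Data.Fin.Properties as Fin
open import Data.Fin.Subset using (Subset; inside; outside; _∈_; ∣_∣)
open import Data.Fin.Subset.Properties using (_∈?_)
open import Data.List.Base using (List; [_]; _++_; map; filter; length)
open import Data.List.Extrema.Nat using (max)
open import Data.Nat.Base as ℕ using (ℕ; zero; suc; _⊔_)
import Data.Nat.Properties as ℕ
open import Data.Product.Base using (_×_; _,_; ∃-syntax)
open import Data.Rational.Base as ℚ using (ℚ; 0ℚ; 1ℚ; ½; Positive; positive)
import Data.Rational.Properties as ℚ
open import Data.Rational.Solver using (module +-*-Solver)
open import Data.Sum.Base using (_⊎_; inj₁; inj₂)
open import Data.Unit.Base using (⊤; tt)
open import Data.Vec.Base using ([]; _∷_)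
open import Level using (0ℓ)
open import Relation.Binary.Core using (Rel)
open import Relation.Binary.Definitions
  using (Decidable; Symmetric; Irreflexive)
open import Relation.Binary.PropositionalEquality
  using (_≡_; refl; sym; trans; cong; cong₂; subst)
open import Relation.Nullary using (¬_; Dec; yes; no)
open import Relation.Nullary.Decidable using (_→-dec_; ¬?)

private
  half-pos : ∀ {ε} → 0ℚ ℚ.< ε → 0ℚ ℚ.< ½ ℚ.* ε
  half-pos 0<ε = ℚ.*-monoʳ-<-pos ½ 0<ε

  half+half : ∀ ε → ½ ℚ.* ε ℚ.+ ½ ℚ.* ε ≡ ε
  half+half ε = trans (sym (ℚ.*-distribʳ-+ ε ½ ½)) (ℚ.*-identityˡ ε)

  ⊔-boundˡ : ∀ {M N n} → M ⊔ N ℕ.≤ n → M ℕ.≤ n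
  ⊔-boundˡ {M} {N} = ℕ.≤-trans (ℕ.m≤m⊔n M N)

  ⊔-boundʳ : ∀ {M N n} → M ⊔ N ℕ.≤ n → N ℕ.≤ n
  ⊔-boundʳ {M} {N} = ℕ.≤-trans (ℕ.m≤n⊔m M N)

Cauchy : (ℕ → ℚ) → Set
Cauchy s = ∀ ε → 0ℚ ℚ.< ε →
  ∃[ N ] (∀ m n → N ℕ.≤ m → N ℕ.≤ n → ℚ.∣ s m ℚ.- s n ∣ ℚ.< ε)

record ℝ : Set where
  constructor mkℝ
  field
    approx : ℕ → ℚ
    cauchy : Cauchy approx

open ℝ public

infix 4 _≈ᴿ_ _<ᴿ_ _≤ᴿ_
infixl 6 _+ᴿ_
infixl 7 _*ᴿ_
infix 8 -ᴿ_

_≈ᴿ_ : Rel ℝ 0ℓ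
x ≈ᴿ y = ∀ ε → 0ℚ ℚ.< ε →
  ∃[ N ] (∀ n → N ℕ.≤ n → ℚ.∣ approx x n ℚ.- approx y n ∣ ℚ.< ε)

_<ᴿ_ : Rel ℝ 0ℓ
x <ᴿ y = ∃[ ε ] 0ℚ ℚ.< ε ×
  (∃[ N ] (∀ n → N ℕ.≤ n → approx x n ℚ.+ ε ℚ.≤ approx y n))

_≤ᴿ_ : Rel ℝ 0ℓ
x ≤ᴿ y = ¬ (y <ᴿ x)

fromℚ : ℚ → ℝ
fromℚ q = mkℝ (λ _ → q) λ ε 0<ε → 0 , λ _ _ _ _ →
  subst (λ d → ℚ.∣ d ∣ ℚ.< ε) (sym (ℚ.+-inverseʳ q)) 0<ε

0ᴿ 1ᴿ : ℝ
0ᴿ = fromℚ 0ℚ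
1ᴿ = fromℚ 1ℚ

_+ᴿ_ : ℝ → ℝ → ℝ
mkℝ x cx +ᴿ mkℝ y cy = mkℝ (λ n → x n ℚ.+ y n) c
  where
  rearrange : ∀ a b a′ b′ →
    (a ℚ.+ b) ℚ.- (a′ ℚ.+ b′) ≡ (a ℚ.- a′) ℚ.+ (b ℚ.- b′)
  rearrange = solve 4
    (λ a b a′ b′ → (a :+ b) :- (a′ :+ b′) := (a :- a′) :+ (b :- b′)) refl
    where open +-*-Solver

  c : Cauchy (λ n → x n ℚ.+ y n)
  c ε 0<ε with cx (½ ℚ.* ε) (half-pos 0<ε) | cy (½ ℚ.* ε) (half-pos 0<ε)
  ... | M , hx | N , hy = M ⊔ N , λ m n m≥ n≥ → begin-strict
    ℚ.∣ (x m ℚ.+ y m) ℚ.- (x n ℚ.+ y n) ∣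
      ≡⟨ cong ℚ.∣_∣ (rearrange (x m) (y m) (x n) (y n)) ⟩
    ℚ.∣ (x m ℚ.- x n) ℚ.+ (y m ℚ.- y n) ∣
      ≤⟨ ℚ.∣p+q∣≤∣p∣+∣q∣ (x m ℚ.- x n) (y m ℚ.- y n) ⟩
    ℚ.∣ x m ℚ.- x n ∣ ℚ.+ ℚ.∣ y m ℚ.- y n ∣
      <⟨ ℚ.+-mono-< (hx m n (⊔-boundˡ m≥) (⊔-boundˡ n≥))
                    (hy m n (⊔-boundʳ {M} m≥) (⊔-boundʳ {M} n≥)) ⟩
    ½ ℚ.* ε ℚ.+ ½ ℚ.* ε
      ≡⟨ half+half ε ⟩
    ε ∎
    where open ℚ.≤-Reasoning

-ᴿ_ : ℝ → ℝ
-ᴿ mkℝ x cx = mkℝ (λ n → ℚ.- x n) c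
  where
  rearrange : ∀ a b → (ℚ.- a) ℚ.- (ℚ.- b) ≡ ℚ.- (a ℚ.- b)
  rearrange = solve 2 (λ a b → (:- a) :- (:- b) := :- (a :- b)) refl
    where open +-*-Solver

  c : Cauchy (λ n → ℚ.- x n)
  c ε 0<ε with cx ε 0<ε
  ... | N , h = N , λ m n m≥ n≥ →
    subst (ℚ._< ε)
      (sym (trans (cong ℚ.∣_∣ (rearrange (x m) (x n)))
                  (ℚ.∣-p∣≡∣p∣ (x m ℚ.- x n))))
      (h m n m≥ n≥)

private
  eventuallyBounded : ∀ {x} → Cauchy x →
    ∃[ B ] Positive B × (∃[ N ] (∀ n → N ℕ.≤ n → ℚ.∣ x n ∣ ℚ.≤ B))
  eventuallyBounded {x} cx with cx 1ℚ (ℚ.positive⁻¹ 1ℚ)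
  ... | N , h =
    1ℚ ℚ.+ ℚ.∣ x N ∣ ,
    ℚ.pos+nonNeg⇒pos 1ℚ ℚ.∣ x N ∣ {{ℚ.nonNegative (ℚ.0≤∣p∣ (x N))}} ,
    N , λ n n≥ → begin
      ℚ.∣ x n ∣
        ≡⟨ cong ℚ.∣_∣ (rearrange (x n) (x N)) ⟩
      ℚ.∣ (x n ℚ.- x N) ℚ.+ x N ∣
        ≤⟨ ℚ.∣p+q∣≤∣p∣+∣q∣ (x n ℚ.- x N) (x N) ⟩
      ℚ.∣ x n ℚ.- x N ∣ ℚ.+ ℚ.∣ x N ∣
        ≤⟨ ℚ.+-monoˡ-≤ ℚ.∣ x N ∣ (ℚ.<⇒≤ (h n N n≥ ℕ.≤-refl)) ⟩
      1ℚ ℚ.+ ℚ.∣ x N ∣ ∎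
    where
    open ℚ.≤-Reasoning
    rearrange : ∀ a b → a ≡ (a ℚ.- b) ℚ.+ b
    rearrange = solve 2 (λ a b → a := (a :- b) :+ b) refl
      where open +-*-Solver

  divideBy : ∀ B → Positive B → ∀ {ε} → 0ℚ ℚ.< ε →
    ∃[ δ ] 0ℚ ℚ.< δ × B ℚ.* δ ≡ ε
  divideBy B B>0 {ε} 0<ε =
    (ℚ.1/ B) ℚ.* ε ,
    ℚ.positive⁻¹ _ {{ℚ.pos*pos⇒pos (ℚ.1/ B) {{ℚ.1/pos⇒pos B}} ε {{positive 0<ε}}}} ,
    trans (sym (ℚ.*-assoc B (ℚ.1/ B) ε))
          (trans (cong (ℚ._* ε) (ℚ.*-inverseʳ B)) (ℚ.*-identityˡ ε))
    where
    instance
      _ : Positive B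
      _ = B>0
      _ : ℚ.NonZero B
      _ = ℚ.pos⇒nonZero B

_*ᴿ_ : ℝ → ℝ → ℝ
mkℝ x cx *ᴿ mkℝ y cy = mkℝ (λ n → x n ℚ.* y n) c
  where
  rearrange : ∀ a b a′ b′ →
    (a ℚ.* b) ℚ.- (a′ ℚ.* b′) ≡ a ℚ.* (b ℚ.- b′) ℚ.+ b′ ℚ.* (a ℚ.- a′)
  rearrange = solve 4
    (λ a b a′ b′ →
      (a :* b) :- (a′ :* b′) := a :* (b :- b′) :+ b′ :* (a :- a′)) refl
    where open +-*-Solver

  scaled : ∀ {B δ} p q → ℚ.∣ p ∣ ℚ.≤ B → Positive B → ℚ.∣ q ∣ ℚ.< δ →
    ℚ.∣ p ℚ.* q ∣ ℚ.< B ℚ.* δ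
  scaled {B} {δ} p q p≤B B>0 q<δ = begin-strict
    ℚ.∣ p ℚ.* q ∣
      ≡⟨ ℚ.∣p*q∣≡∣p∣*∣q∣ p q ⟩
    ℚ.∣ p ∣ ℚ.* ℚ.∣ q ∣
      ≤⟨ ℚ.*-monoʳ-≤-nonNeg ℚ.∣ q ∣ {{ℚ.nonNegative (ℚ.0≤∣p∣ q)}} p≤B ⟩
    B ℚ.* ℚ.∣ q ∣
      <⟨ ℚ.*-monoʳ-<-pos B {{B>0}} q<δ ⟩
    B ℚ.* δ ∎
    where open ℚ.≤-Reasoning

  productBound : ∀ {A B δ η} a b a′ b′ → Positive A → Positive B →
    ℚ.∣ a ∣ ℚ.≤ A → ℚ.∣ b′ ∣ ℚ.≤ B →
    ℚ.∣ b ℚ.- b′ ∣ ℚ.< δ → ℚ.∣ a ℚ.- a′ ∣ ℚ.< η →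
    ℚ.∣ (a ℚ.* b) ℚ.- (a′ ℚ.* b′) ∣ ℚ.< A ℚ.* δ ℚ.+ B ℚ.* η
  productBound {A} {B} {δ} {η} a b a′ b′ A>0 B>0 a≤A b′≤B b-b′ a-a′ =
    begin-strict
    ℚ.∣ (a ℚ.* b) ℚ.- (a′ ℚ.* b′) ∣
      ≡⟨ cong ℚ.∣_∣ (rearrange a b a′ b′) ⟩
    ℚ.∣ a ℚ.* (b ℚ.- b′) ℚ.+ b′ ℚ.* (a ℚ.- a′) ∣
      ≤⟨ ℚ.∣p+q∣≤∣p∣+∣q∣ (a ℚ.* (b ℚ.- b′)) (b′ ℚ.* (a ℚ.- a′)) ⟩
    ℚ.∣ a ℚ.* (b ℚ.- b′) ∣ ℚ.+ ℚ.∣ b′ ℚ.* (a ℚ.- a′) ∣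
      <⟨ ℚ.+-mono-< (scaled a (b ℚ.- b′) a≤A A>0 b-b′)
                    (scaled b′ (a ℚ.- a′) b′≤B B>0 a-a′) ⟩
    A ℚ.* δ ℚ.+ B ℚ.* η ∎
    where open ℚ.≤-Reasoning

  c : Cauchy (λ n → x n ℚ.* y n)
  c ε 0<ε =
    let A , A>0 , Nx , bx = eventuallyBounded cx
        B , B>0 , Ny , by = eventuallyBounded cy
        δ , 0<δ , Aδ≡ε/2 = divideBy A A>0 (half-pos 0<ε)
        η , 0<η , Bη≡ε/2 = divideBy B B>0 (half-pos 0<ε)
        M , hy = cy δ 0<δ
        N , hx = cx η 0<η
        sum≡ε : A ℚ.* δ ℚ.+ B ℚ.* η ≡ ε
        sum≡ε = trans (cong₂ ℚ._+_ Aδ≡ε/2 Bη≡ε/2) (half+half ε)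
    in (Nx ⊔ Ny) ⊔ (M ⊔ N) , λ m n m≥ n≥ →
      let m≥₁ = ⊔-boundˡ {Nx ⊔ Ny} {M ⊔ N} m≥
          n≥₁ = ⊔-boundˡ {Nx ⊔ Ny} {M ⊔ N} n≥
          m≥₂ = ⊔-boundʳ {Nx ⊔ Ny} {M ⊔ N} m≥
          n≥₂ = ⊔-boundʳ {Nx ⊔ Ny} {M ⊔ N} n≥
      in subst (ℚ.∣ (x m ℚ.* y m) ℚ.- (x n ℚ.* y n) ∣ ℚ.<_) sum≡ε
           (productBound (x m) (y m) (x n) (y n) A>0 B>0
             (bx m (⊔-boundˡ {Nx} {Ny} m≥₁)) (by n (⊔-boundʳ {Nx} {Ny} n≥₁))
             (hy m n (⊔-boundˡ {M} {N} m≥₂) (⊔-boundˡ {M} {N} n≥₂))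
             (hx m n (⊔-boundʳ {M} {N} m≥₂) (⊔-boundʳ {M} {N} n≥₂)))

record ℂ : Set where
  constructor _+i_
  field
    Re Im : ℝ

open ℂ public

infix 5 _+i_
infix 4 _≈ᶜ_
infixl 6 _+ᶜ_
infixl 7 _*ᶜ_

_≈ᶜ_ : Rel ℂ 0ℓ
z ≈ᶜ w = (Re z ≈ᴿ Re w) × (Im z ≈ᴿ Im w)

0ᶜ 1ᶜ : ℂ
0ᶜ = 0ᴿ +i 0ᴿ
1ᶜ = 1ᴿ +i 0ᴿ

_+ᶜ_ : ℂ → ℂ → ℂ
(a +i b) +ᶜ (c +i d) = (a +ᴿ c) +i (b +ᴿ d)

_*ᶜ_ : ℂ → ℂ → ℂ
(a +i b) *ᶜ (c +i d) =
  (a *ᴿ c +ᴿ (-ᴿ (b *ᴿ d))) +i (a *ᴿ d +ᴿ b *ᴿ c)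

ℂ-rawSemiring : RawSemiring 0ℓ 0ℓ
ℂ-rawSemiring = record
  { Carrier = ℂ ; _≈_ = _≈ᶜ_ ; _+_ = _+ᶜ_ ; _*_ = _*ᶜ_ ; 0# = 0ᶜ ; 1# = 1ᶜ }

record SimpleGraph (n : ℕ) : Set₁ where
  field
    Adj    : Rel (Fin n) 0ℓ
    adj?   : Decidable Adj
    symm   : Symmetric Adj
    irrefl : Irreflexive _≡_ Adj

allSubsets : ∀ n → List (Subset n)
allSubsets zero    = [ [] ]
allSubsets (suc n) =
  map (outside ∷_) (allSubsets n) ++ map (inside ∷_) (allSubsets n)

module _ {n : ℕ} (G : SimpleGraph n) where
  open SimpleGraph G

  Independent : Subset n → Set
  Independent S = ∀ u v → u ∈ S → v ∈ S → ¬ Adj u v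

  independent? : ∀ S → Dec (Independent S)
  independent? S = Fin.all? λ u → Fin.all? λ v →
    (u ∈? S) →-dec ((v ∈? S) →-dec ¬? (adj? u v))

  independentSets : List (Subset n)
  independentSets = filter independent? (allSubsets n)

  independentCount : ℕ → ℕ
  independentCount k = length (filter (λ S → ∣ S ∣ ℕ.≟ k) independentSets)

  independenceNumber : ℕ
  independenceNumber = max 0 (map ∣_∣ independentSets)

  independencePolynomial : ℂ → ℂ
  independencePolynomial z =
    sum {suc independenceNumber} λ k → independentCount (toℕ k) · (z ^ toℕ k)
    where open RawSemiringDefinitions ℂ-rawSemiring
            using (sum; _^_) renaming (_×_ to _·_)

  Stable : Set
  Stable = ∀ z → independencePolynomial z ≈ᶜ 0ᶜ → Re z ≤ᴿ 0ᴿ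

OppositeSides : ∀ {A B : Set} → Rel (A ⊎ B) 0ℓ
OppositeSides (inj₁ _) (inj₁ _) = ⊥
OppositeSides (inj₁ _) (inj₂ _) = ⊤
OppositeSides (inj₂ _) (inj₁ _) = ⊤
OppositeSides (inj₂ _) (inj₂ _) = ⊥

private
  oppositeSides? : ∀ {A B : Set} → Decidable (OppositeSides {A} {B})
  oppositeSides? (inj₁ _) (inj₁ _) = no λ ()
  oppositeSides? (inj₁ _) (inj₂ _) = yes tt
  oppositeSides? (inj₂ _) (inj₁ _) = yes tt
  oppositeSides? (inj₂ _) (inj₂ _) = no λ ()

  oppositeSides-sym : ∀ {A B : Set} (s t : A ⊎ B) →
    OppositeSides s t → OppositeSides t s
  oppositeSides-sym (inj₁ _) (inj₂ _) _ = tt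
  oppositeSides-sym (inj₂ _) (inj₁ _) _ = tt

  oppositeSides-irrefl : ∀ {A B : Set} (s : A ⊎ B) → ¬ OppositeSides s s
  oppositeSides-irrefl (inj₁ _) ()
  oppositeSides-irrefl (inj₂ _) ()

-- The two parts are the first a and the last b elements of Fin (a + b).
K : ∀ a b → SimpleGraph (a ℕ.+ b)
K a b = record
  { Adj    = λ u v → OppositeSides (splitAt a u) (splitAt a v)
  ; adj?   = λ u v → oppositeSides? (splitAt a u) (splitAt a v)
  ; symm   = λ {u} {v} → oppositeSides-sym (splitAt a u) (splitAt a v)
  ; irrefl = λ { {u} refl → oppositeSides-irrefl (splitAt a u) }
  }

{-# OPTIONS --safe #-}
module Submission where

-- With w = 1 + z the polynomial of K_{m,m+k} is w^m (1 + w^k) − 1, so it suffices to keep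
-- |w|^m |1 + w^k| above 1 when Re w > 1; as |w| > 1, this holds once |1 + w^k| ≥ 1.
-- For k ≤ 6, writing w = u (1 + iτ) with u ≥ 1, the inequality |1 + w^k| ≥ 1 follows from
-- (1 + τ²)^k + 2 Re (1 + iτ)^k ≥ 0, a polynomial inequality in s = τ² ≥ 0.
-- For general k there is η > 0 such that |Im w| ≤ η forces Re w^k ≥ 0, hence |1 + w^k| ≥ 1.
-- Otherwise |w|² ≥ 1 + η², so |1 + w^k| ≥ |w|^k − 1 is bounded below independently of m, and
-- |w|^m beats this bound once m is large.
-- All estimates are made on the rational approximations of z; a positive lower bound ε for
-- Re z gives | i(z) + 1 |² ≥ 1 + ε along them, which excludes i(z) = 0.

open import Algebra.Bundles using (CommutativeRing; CommutativeSemiring)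
import Algebra.Properties.CommutativeMonoid.Sum as Sum
import Algebra.Properties.CommutativeSemiring.Exp as CExp
import Algebra.Properties.Semiring.Exp as Exp
import Algebra.Properties.Semiring.Mult as Mult
import Algebra.Structures.Biased as Biased
open import Data.Bool.Base using (true; false; if_then_else_)
open import Data.Empty using (⊥-elim)
open import Data.Fin.Base using (Fin; zero; suc; toℕ; splitAt; _↑ʳ_)
open import Data.Fin.Properties using (splitAt⁻¹-↑ʳ; splitAt-↑ʳ)
open import Data.Fin.Subset as Subset using (Subset; inside; outside; _∈_; _∉_)
open import Data.Fin.Subset.Properties using (drop-there)
import Data.Integer.Base as ℤ
import Data.Integer.Properties as ℤ
open import Data.List.Base using (List; []; _∷_; _++_; map; filter; length)
open import Data.List.Extrema.Nat using (xs≤max)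
open import Data.List.Properties using (filter-++; filter-none)
open import Data.List.Relation.Unary.All as All using (All; []; _∷_)
import Data.List.Relation.Unary.All.Properties as All
open import Data.Nat.Base as ℕ using (ℕ; zero; suc; z≤n; s≤s)
import Data.Nat.Properties as ℕ
open import Data.Product.Base using (_×_; _,_; proj₁; proj₂; ∃-syntax)
open import Data.Rational.Solver using (module +-*-Solver)
import Data.Rational.Unnormalised.Base as ℚᵘ
import Data.Rational.Unnormalised.Properties as ℚᵘ
open import Data.Sum.Base as Sum⊎ using (_⊎_; inj₁; inj₂)
open import Data.Unit.Base using (tt)
open import Data.Vec.Base using ([]; _∷_; here; there)
open import Function.Base using (_∘_; id; case_of_)
open import Level using (0ℓ)
open import Relation.Binary.PropositionalEquality
  using (_≡_; refl; sym; trans; cong; cong₂; subst; isEquivalence; module ≡-Reasoning)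
open import Relation.Nullary using (¬_; does; yes; no)
open import Relation.Unary using (Pred; Decidable; _≐_; _⊢_)

open import Defs

-- Counting independent sets

filter-map : ∀ {A B : Set} (f : A → B) {P : Pred B 0ℓ} (P? : Decidable P) xs →
  filter P? (map f xs) ≡ map f (filter (P? ∘ f) xs)
filter-map f P? [] = refl
filter-map f P? (x ∷ xs) with does (P? (f x))
... | true  = cong (f x ∷_) (filter-map f P? xs)
... | false = filter-map f P? xs

filter-allSubsets : ∀ n {P : Pred (Subset (suc n)) 0ℓ} (P? : Decidable P) →
  filter P? (allSubsets (suc n)) ≡
    map (outside ∷_) (filter (P? ∘ (outside ∷_)) (allSubsets n)) ++
    map (inside ∷_) (filter (P? ∘ (inside ∷_)) (allSubsets n))
filter-allSubsets n P? = trans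
  (filter-++ P? (map (outside ∷_) (allSubsets n)) _)
  (cong₂ _++_ (filter-map (outside ∷_) P? (allSubsets n))
              (filter-map (inside ∷_) P? (allSubsets n)))

AvoidsRight : ∀ a {b} → Pred (Subset (a ℕ.+ b)) 0ℓ
AvoidsRight a {b} S = ∀ (v : Fin b) → a ↑ʳ v ∉ S

oppositeSides-map : ∀ {A A′ B : Set} (f : A → A′) (s t : A ⊎ B) →
  OppositeSides (Sum⊎.map f id s) (Sum⊎.map f id t) ≡ OppositeSides s t
oppositeSides-map f (inj₁ _) (inj₁ _) = refl
oppositeSides-map f (inj₁ _) (inj₂ _) = refl
oppositeSides-map f (inj₂ _) (inj₁ _) = refl
oppositeSides-map f (inj₂ _) (inj₂ _) = refl

-- Dropping an unchosen left vertex only relabels the left part, and `OppositeSides` depends on the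
-- sides alone, not on the labels.
independent-outside : ∀ a b →
  (outside ∷_) ⊢ Independent (K (suc a) b) ≐ Independent (K a b)
independent-outside a b = to , from
  where
  adj≡ : ∀ u v → SimpleGraph.Adj (K (suc a) b) (suc u) (suc v) ≡ SimpleGraph.Adj (K a b) u v
  adj≡ u v = oppositeSides-map suc (splitAt a u) (splitAt a v)

  to : ∀ {S} → Independent (K (suc a) b) (outside ∷ S) → Independent (K a b) S
  to ind u v u∈ v∈ adj = ind (suc u) (suc v) (there u∈) (there v∈)
    (subst id (sym (adj≡ u v)) adj)

  from : ∀ {S} → Independent (K a b) S → Independent (K (suc a) b) (outside ∷ S)
  from ind (suc u) (suc v) (there u∈) (there v∈) adj =
    ind u v u∈ v∈ (subst id (adj≡ u v) adj)

-- A chosen left vertex is adjacent to every right vertex, so none of those may be chosen.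
-- Conversely, a set without right vertices lies in the left part, which spans no edge.
independent-inside : ∀ a b →
  (inside ∷_) ⊢ Independent (K (suc a) b) ≐ AvoidsRight a {b}
independent-inside a b = to , from
  where
  to : ∀ {S} → Independent (K (suc a) b) (inside ∷ S) → AvoidsRight a S
  to ind v v∈ = ind zero (suc (a ↑ʳ v)) here (there v∈)
    (subst (OppositeSides (inj₁ zero)) (sym (splitAt-↑ʳ (suc a) b v)) tt)

  left : ∀ {S} → AvoidsRight a S → ∀ u → u ∈ inside ∷ S →
    ∃[ i ] splitAt (suc a) {b} u ≡ inj₁ i
  left avoids u u∈ with splitAt (suc a) u in eq
  ... | inj₁ i = i , refl
  ... | inj₂ j = ⊥-elim (avoids j
    (drop-there (subst (_∈ _) (sym (splitAt⁻¹-↑ʳ {suc a} eq)) u∈)))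

  from : ∀ {S} → AvoidsRight a S → Independent (K (suc a) b) (inside ∷ S)
  from avoids u v u∈ v∈ adj
    with splitAt (suc a) u | left avoids u u∈ | splitAt (suc a) v | left avoids v v∈
  from avoids u v u∈ v∈ () | _ | _ , refl | _ | _ , refl

-- The independence polynomial of a complete bipartite graph

module IndependencePolynomial (R : CommutativeSemiring 0ℓ 0ℓ) where
  open CommutativeSemiring R hiding (refl; sym; trans; zero)
  open CommutativeSemiring R using () renaming (refl to ≈-refl; sym to ≈-sym; trans to ≈-trans)
  open Sum +-commutativeMonoid using (sum-cong-≋; sum-replicate-zero; ∑-distrib-+)
  open import Algebra.Definitions.RawSemiring rawSemiring using (sum; _^_) renaming (_×_ to _·_)
  open import Relation.Binary.Reasoning.Setoid setoid

  -- This repeats the sum in `independencePolynomial` over an arbitrary commutative semiring, so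
  -- that it can be evaluated in ℚ[i], where equality is propositional.
  polynomial : ∀ {n} → SimpleGraph n → Carrier → Carrier
  polynomial G z =
    sum {suc (independenceNumber G)} λ k → independentCount G (toℕ k) · (z ^ toℕ k)

  module _ (z : Carrier) where

    weight : ∀ {n} → List (Subset n) → Carrier
    weight []      = 0#
    weight (S ∷ L) = z ^ Subset.∣ S ∣ + weight L

    weight-++ : ∀ {n} (L M : List (Subset n)) → weight (L ++ M) ≈ weight L + weight M
    weight-++ []      M = ≈-sym (+-identityˡ _)
    weight-++ (S ∷ L) M = ≈-trans (+-congˡ (weight-++ L M)) (≈-sym (+-assoc _ _ _))

    weight-outside : ∀ {n} (L : List (Subset n)) → weight (map (outside ∷_) L) ≈ weight L
    weight-outside []      = ≈-refl
    weight-outside (S ∷ L) = +-congˡ (weight-outside L)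

    weight-inside : ∀ {n} (L : List (Subset n)) → weight (map (inside ∷_) L) ≈ z * weight L
    weight-inside []      = ≈-sym (zeroʳ z)
    weight-inside (S ∷ L) = ≈-trans (+-congˡ (weight-inside L)) (≈-sym (distribˡ z _ _))

    sum-select : ∀ (f : ℕ → Carrier) {s n} → s ℕ.≤ n →
      sum {suc n} (λ i → if does (s ℕ.≟ toℕ i) then f (toℕ i) else 0#) ≈ f s
    sum-select f {zero}  {n}     _         =
      ≈-trans (+-congˡ (sum-replicate-zero n)) (+-identityʳ _)
    sum-select f {suc s} {suc n} (s≤s s≤n) =
      ≈-trans (+-identityˡ _) (sum-select (f ∘ suc) s≤n)

    -- A double count: each set contributes to exactly one degree, its size, and the bound `n`
    -- ensures that this degree occurs in the sum.
    sum-by-size : ∀ {m n} (L : List (Subset m)) → All (λ S → Subset.∣ S ∣ ℕ.≤ n) L →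
      sum {suc n} (λ i → length (filter (λ S → Subset.∣ S ∣ ℕ.≟ toℕ i) L) · (z ^ toℕ i)) ≈ weight L
    sum-by-size {n = n} []      []             = sum-replicate-zero (suc n)
    sum-by-size {n = n} (S ∷ L) (S≤n ∷ L≤n) = begin
      sum {suc n} (λ i → count i (S ∷ L) · (z ^ toℕ i))
        ≈⟨ sum-cong-≋ step ⟩
      sum {suc n} (λ i → selected i + count i L · (z ^ toℕ i))
        ≈⟨ ∑-distrib-+ selected (λ i → count i L · (z ^ toℕ i)) ⟩
      sum selected + sum (λ i → count i L · (z ^ toℕ i))
        ≈⟨ +-cong (sum-select (z ^_) S≤n) (sum-by-size L L≤n) ⟩
      z ^ Subset.∣ S ∣ + weight L ∎
      where
      count : Fin (suc n) → List (Subset _) → ℕ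
      count i M = length (filter (λ S → Subset.∣ S ∣ ℕ.≟ toℕ i) M)

      selected : Fin (suc n) → Carrier
      selected i = if does (Subset.∣ S ∣ ℕ.≟ toℕ i) then z ^ toℕ i else 0#

      step : ∀ i → count i (S ∷ L) · (z ^ toℕ i) ≈ selected i + count i L · (z ^ toℕ i)
      step i with does (Subset.∣ S ∣ ℕ.≟ toℕ i)
      ... | true  = ≈-refl
      ... | false = ≈-sym (+-identityˡ _)

    -- Cutting the sum off at the independence number loses no set, because that number is the
    -- maximum of the sizes.
    polynomial≈weight : ∀ {n} (G : SimpleGraph n) →
      polynomial G z ≈ weight (independentSets G)
    polynomial≈weight G = sum-by-size (independentSets G)
      (All.map⁻ (xs≤max 0 (map Subset.∣_∣ (independentSets G))))

    -- The case split on the first vertex, which adds a factor `z` when chosen. It drives all the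
    -- evaluations below.
    weight-filter : ∀ n {P : Pred (Subset (suc n)) 0ℓ} (P? : Decidable P) →
      weight (filter P? (allSubsets (suc n))) ≈
        weight (filter (P? ∘ (outside ∷_)) (allSubsets n)) +
        z * weight (filter (P? ∘ (inside ∷_)) (allSubsets n))
    weight-filter n P? = begin
      weight (filter P? (allSubsets (suc n)))
        ≡⟨ cong weight (filter-allSubsets n P?) ⟩
      weight (map (outside ∷_) Out ++ map (inside ∷_) In)
        ≈⟨ weight-++ (map (outside ∷_) Out) _ ⟩
      weight (map (outside ∷_) Out) + weight (map (inside ∷_) In)
        ≈⟨ +-cong (weight-outside Out) (weight-inside In) ⟩
      weight Out + z * weight In ∎
      where
      Out = filter (P? ∘ (outside ∷_)) (allSubsets n)
      In  = filter (P? ∘ (inside ∷_)) (allSubsets n)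

    w : Carrier
    w = 1# + z

    x+z*x≈w*x : ∀ x → x + z * x ≈ w * x
    x+z*x≈w*x x = ≈-trans (+-congʳ (≈-sym (*-identityˡ x))) (≈-sym (distribʳ x 1# z))

    weight-all : ∀ n {P : Pred (Subset n) 0ℓ} (P? : Decidable P) → (∀ S → P S) →
      weight (filter P? (allSubsets n)) ≈ w ^ n
    weight-all zero    P? all with P? []
    ... | no ¬p = ⊥-elim (¬p (all []))
    ... | yes _ = +-identityʳ 1#
    weight-all (suc n) P? all = begin
      weight (filter P? (allSubsets (suc n)))
        ≈⟨ weight-filter n P? ⟩
      _ + z * _
        ≈⟨ +-cong (weight-all n (P? ∘ (outside ∷_)) (all ∘ (outside ∷_)))
             (*-congˡ (weight-all n (P? ∘ (inside ∷_)) (all ∘ (inside ∷_)))) ⟩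
      w ^ n + z * w ^ n
        ≈⟨ x+z*x≈w*x (w ^ n) ⟩
      w ^ suc n ∎

    weight-none : ∀ n {P : Pred (Subset n) 0ℓ} (P? : Decidable P) → (∀ S → ¬ P S) →
      weight (filter P? (allSubsets n)) ≈ 0#
    weight-none n P? none =
      reflexive (cong weight (filter-none P? (All.universal none (allSubsets n))))

    -- Every left vertex is free and gives a factor 1 + z; every right vertex is excluded and gives
    -- a factor 1. `P` is fixed only up to `≐`, since after a split the filter predicate is a
    -- composite that merely agrees with the smaller instance.
    weight-avoidsRight : ∀ a b {P : Pred (Subset (a ℕ.+ b)) 0ℓ} (P? : Decidable P) →
      P ≐ AvoidsRight a → weight (filter P? (allSubsets (a ℕ.+ b))) ≈ w ^ a
    weight-avoidsRight zero zero P? (_ , from) = weight-all zero P? λ { [] → from λ () }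
    weight-avoidsRight zero (suc b) P? (to , from) = begin
      weight (filter P? (allSubsets (suc b)))
        ≈⟨ weight-filter b P? ⟩
      _ + z * _
        ≈⟨ +-cong
             (weight-avoidsRight zero b (P? ∘ (outside ∷_))
               ( (λ p v v∈ → to p (suc v) (there v∈))
               , (λ avoids → from λ { (suc v) (there v∈) → avoids v v∈ }) ))
             (*-congˡ (weight-none b (P? ∘ (inside ∷_)) (λ S p → to p zero here))) ⟩
      1# + z * 0#
        ≈⟨ +-congˡ (zeroʳ z) ⟩
      1# + 0#
        ≈⟨ +-identityʳ 1# ⟩
      1# ∎
    weight-avoidsRight (suc a) b P? (to , from) = begin
      weight (filter P? (allSubsets (suc a ℕ.+ b)))
        ≈⟨ weight-filter (a ℕ.+ b) P? ⟩
      _ + z * _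
        ≈⟨ +-cong (weight-avoidsRight a b (P? ∘ (outside ∷_)) (to′ , from′))
             (*-congˡ (weight-avoidsRight a b (P? ∘ (inside ∷_)) (to′ , from′))) ⟩
      w ^ a + z * w ^ a
        ≈⟨ x+z*x≈w*x (w ^ a) ⟩
      w ^ suc a ∎
      where
      to′ : ∀ {x S} → _ → AvoidsRight a S
      to′ {x} {S} p v v∈ = to {x ∷ S} p v (there v∈)

      from′ : ∀ {x S} → AvoidsRight a S → _
      from′ {x} {S} avoids = from {x ∷ S} λ v v∈ → avoids v (drop-there v∈)

    -- Independent sets lie within one part, and the empty set lies in both; the `1#` on the left
    -- restores its second count without subtraction. In the induction on `a`, the sets containing
    -- the first left vertex contribute `z * w ^ a`, which raises `w ^ a` to `w ^ suc a`.
    weight-independent : ∀ a b {P : Pred (Subset (a ℕ.+ b)) 0ℓ} (P? : Decidable P) →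
      P ≐ Independent (K a b) →
      weight (filter P? (allSubsets (a ℕ.+ b))) + 1# ≈ w ^ a + w ^ b
    weight-independent zero b P? (_ , from) = begin
      weight (filter P? (allSubsets b)) + 1#
        ≈⟨ +-congʳ (weight-all b P? (λ S → from λ _ _ _ _ ())) ⟩
      w ^ b + 1#
        ≈⟨ +-comm _ _ ⟩
      1# + w ^ b ∎
    weight-independent (suc a) b P? (to , from) = begin
      weight (filter P? (allSubsets (suc a ℕ.+ b))) + 1#
        ≈⟨ +-congʳ (weight-filter (a ℕ.+ b) P?) ⟩
      (Out + z * In) + 1#
        ≈⟨ +-congʳ (+-congˡ (*-congˡ (weight-avoidsRight a b (P? ∘ (inside ∷_))
             ((proj₁ (independent-inside a b) ∘ to) , (from ∘ proj₂ (independent-inside a b)))))) ⟩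
      (Out + z * w ^ a) + 1#
        ≈⟨ shuffle Out (z * w ^ a) 1# ⟩
      (Out + 1#) + z * w ^ a
        ≈⟨ +-congʳ (weight-independent a b (P? ∘ (outside ∷_))
             ((proj₁ (independent-outside a b) ∘ to) , (from ∘ proj₂ (independent-outside a b)))) ⟩
      (w ^ a + w ^ b) + z * w ^ a
        ≈⟨ shuffle (w ^ a) (w ^ b) (z * w ^ a) ⟩
      (w ^ a + z * w ^ a) + w ^ b
        ≈⟨ +-congʳ (x+z*x≈w*x (w ^ a)) ⟩
      w ^ suc a + w ^ b ∎
      where
      Out = weight (filter (P? ∘ (outside ∷_)) (allSubsets (a ℕ.+ b)))
      In  = weight (filter (P? ∘ (inside ∷_)) (allSubsets (a ℕ.+ b)))

      shuffle : ∀ x y t → (x + y) + t ≈ (x + t) + y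
      shuffle x y t = ≈-trans (+-assoc x y t)
        (≈-trans (+-congˡ (+-comm y t)) (≈-sym (+-assoc x t y)))

    polynomial-K : ∀ a b → polynomial (K a b) z + 1# ≈ w ^ a + w ^ b
    polynomial-K a b = ≈-trans (+-congʳ (polynomial≈weight (K a b)))
      (weight-independent a b (independent? (K a b)) (id , id))

-- Estimates over ℚ[i]

module Estimates where
  open import Data.Integer.Base using (+_)
  open import Data.Rational.Base
  open import Data.Rational.Properties
  open +-*-Solver using (solve; Polynomial; con; _:+_; _:*_; _:-_; :-_; _:=_)
  open import Algebra.Definitions.RawSemiring ℂ-rawSemiring using ()
    renaming (sum to sumᶜ; _^_ to _^ᶜ_; _×_ to _·ᶜ_)

  infixl 6 _+ᵢ_
  infixl 7 _*ᵢ_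

  ℚ[i] : Set
  ℚ[i] = ℚ × ℚ

  -- The formulas copy those of `_+ᶜ_` and `_*ᶜ_` literally, so that `at n` commutes with both by
  -- reduction.
  _+ᵢ_ _*ᵢ_ : ℚ[i] → ℚ[i] → ℚ[i]
  (a , b) +ᵢ (c , d) = a + c , b + d
  (a , b) *ᵢ (c , d) = a * c + - (b * d) , a * d + b * c

  0ᵢ 1ᵢ : ℚ[i]
  0ᵢ = 0ℚ , 0ℚ
  1ᵢ = 1ℚ , 0ℚ

  ℚ[i]-commutativeSemiring : CommutativeSemiring 0ℓ 0ℓ
  ℚ[i]-commutativeSemiring = record
    { Carrier = ℚ[i] ; _≈_ = _≡_ ; _+_ = _+ᵢ_ ; _*_ = _*ᵢ_ ; 0# = 0ᵢ ; 1# = 1ᵢ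
    ; isCommutativeSemiring = Biased.isCommutativeSemiringˡ record
      { +-isCommutativeMonoid = Biased.isCommutativeMonoidˡ record
        { isSemigroup = record
          { isMagma = record { isEquivalence = isEquivalence ; ∙-cong = cong₂ _+ᵢ_ }
          ; assoc = λ { (a , b) (c , d) (e , f) → cong₂ _,_ (+-assoc a c e) (+-assoc b d f) }
          }
        ; identityˡ = λ { (a , b) → cong₂ _,_ (+-identityˡ a) (+-identityˡ b) }
        ; comm = λ { (a , b) (c , d) → cong₂ _,_ (+-comm a c) (+-comm b d) }
        }
      ; *-isCommutativeMonoid = Biased.isCommutativeMonoidˡ record
        { isSemigroup = record
          { isMagma = record { isEquivalence = isEquivalence ; ∙-cong = cong₂ _*ᵢ_ }
          ; assoc = λ { (a , b) (c , d) (e , f) → cong₂ _,_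
              (solve 6 (λ a b c d e f →
                (a :* c :+ :- (b :* d)) :* e :+ :- ((a :* d :+ b :* c) :* f) :=
                a :* (c :* e :+ :- (d :* f)) :+ :- (b :* (c :* f :+ d :* e))) refl a b c d e f)
              (solve 6 (λ a b c d e f →
                (a :* c :+ :- (b :* d)) :* f :+ (a :* d :+ b :* c) :* e :=
                a :* (c :* f :+ d :* e) :+ b :* (c :* e :+ :- (d :* f))) refl a b c d e f) }
          }
        ; identityˡ = λ { (a , b) → cong₂ _,_
            (solve 2 (λ a b → con 1ℚ :* a :+ :- (con 0ℚ :* b) := a) refl a b)
            (solve 2 (λ a b → con 1ℚ :* b :+ con 0ℚ :* a := b) refl a b) }
        ; comm = λ { (a , b) (c , d) → cong₂ _,_
            (solve 4 (λ a b c d → a :* c :+ :- (b :* d) := c :* a :+ :- (d :* b)) refl a b c d)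
            (solve 4 (λ a b c d → a :* d :+ b :* c := c :* b :+ d :* a) refl a b c d) }
        }
      ; distribʳ = λ { (a , b) (c , d) (e , f) → cong₂ _,_
          (solve 6 (λ a b c d e f →
            (c :+ e) :* a :+ :- ((d :+ f) :* b) :=
            (c :* a :+ :- (d :* b)) :+ (e :* a :+ :- (f :* b))) refl a b c d e f)
          (solve 6 (λ a b c d e f →
            (c :+ e) :* b :+ (d :+ f) :* a :=
            (c :* b :+ d :* a) :+ (e :* b :+ f :* a)) refl a b c d e f) }
      ; zeroˡ = λ { (a , b) → cong₂ _,_
          (solve 2 (λ a b → con 0ℚ :* a :+ :- (con 0ℚ :* b) := con 0ℚ) refl a b)
          (solve 2 (λ a b → con 0ℚ :* b :+ con 0ℚ :* a := con 0ℚ) refl a b) }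
      }
    }

  open IndependencePolynomial ℚ[i]-commutativeSemiring using (polynomial; polynomial-K)
  open import Algebra.Definitions.RawSemiring
    (CommutativeSemiring.rawSemiring ℚ[i]-commutativeSemiring)
    using () renaming (sum to sumᵢ; _^_ to _^ᵢ_; _×_ to _·ᵢ_)
  open CExp ℚ[i]-commutativeSemiring using () renaming (^-distrib-* to ^ᵢ-distrib-*ᵢ)
  open Exp (CommutativeSemiring.semiring ℚ[i]-commutativeSemiring)
    using () renaming (^-homo-* to ^ᵢ-homo-*ᵢ)
  open import Algebra.Definitions.RawSemiring +-*-rawSemiring using (_^_) renaming (_×_ to _·_)

  -- The operations of ℝ act termwise, so every index n gives a ring homomorphism from ℂ to ℚ[i].
  at : ℕ → ℂ → ℚ[i]
  at n z = approx (Re z) n , approx (Im z) n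

  at-^ : ∀ n z k → at n (z ^ᶜ k) ≡ at n z ^ᵢ k
  at-^ n z zero    = refl
  at-^ n z (suc k) = cong (at n z *ᵢ_) (at-^ n z k)

  at-· : ∀ n k z → at n (k ·ᶜ z) ≡ k ·ᵢ at n z
  at-· n zero    z = refl
  at-· n (suc k) z = cong (at n z +ᵢ_) (at-· n k z)

  at-sum : ∀ n {m} (f : Fin m → ℂ) (g : Fin m → ℚ[i]) → (∀ i → at n (f i) ≡ g i) →
    at n (sumᶜ f) ≡ sumᵢ g
  at-sum n {zero}  f g f≡g = refl
  at-sum n {suc m} f g f≡g = cong₂ _+ᵢ_ (f≡g zero) (at-sum n (f ∘ suc) (g ∘ suc) (f≡g ∘ suc))

  at-independencePolynomial : ∀ n {m} (G : SimpleGraph m) z →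
    at n (independencePolynomial G z) ≡ polynomial G (at n z)
  at-independencePolynomial n G z = at-sum n {suc (independenceNumber G)}
    (λ k → independentCount G (toℕ k) ·ᶜ (z ^ᶜ toℕ k)) _
    λ k → trans (at-· n (independentCount G (toℕ k)) (z ^ᶜ toℕ k))
                (cong (independentCount G (toℕ k) ·ᵢ_) (at-^ n z (toℕ k)))

  -- Inequalities between rationals

  infixl 6 _⊕_
  infixl 7 _⊗_

  _⊕_ : ∀ {p q} → 0ℚ ≤ p → 0ℚ ≤ q → 0ℚ ≤ p + q
  _⊕_ = +-mono-≤

  _⊗_ : ∀ {p q} → 0ℚ ≤ p → 0ℚ ≤ q → 0ℚ ≤ p * q
  _⊗_ {p} {q} 0≤p 0≤q = nonNegative⁻¹ (p * q)
    {{nonNeg*nonNeg⇒nonNeg p {{nonNegative 0≤p}} q {{nonNegative 0≤q}}}}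

  0<* : ∀ {p q} → 0ℚ < p → 0ℚ < q → 0ℚ < p * q
  0<* {p} {q} 0<p 0<q = positive⁻¹ (p * q) {{pos*pos⇒pos p {{positive 0<p}} q {{positive 0<q}}}}

  p*p≡∣p∣*∣p∣ : ∀ p → p * p ≡ ∣ p ∣ * ∣ p ∣
  p*p≡∣p∣*∣p∣ p with ∣p∣≡p∨∣p∣≡-p p
  ... | inj₁ eq = sym (cong₂ _*_ eq eq)
  ... | inj₂ eq = sym (trans (cong₂ _*_ eq eq) (solve 1 (λ p → :- p :* :- p := p :* p) refl p))

  0≤p*p : ∀ p → 0ℚ ≤ p * p
  0≤p*p p = subst (0ℚ ≤_) (sym (p*p≡∣p∣*∣p∣ p)) (0≤∣p∣ p ⊗ 0≤∣p∣ p)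

  p≤q⇒0≤q-p : ∀ {p q} → p ≤ q → 0ℚ ≤ q - p
  p≤q⇒0≤q-p {p} {q} p≤q = subst (_≤ q - p) (+-inverseʳ p) (+-monoˡ-≤ (- p) p≤q)

  ≤-from-gap : ∀ {p q} d → 0ℚ ≤ d → q ≡ p + d → p ≤ q
  ≤-from-gap {p} d 0≤d refl = subst (_≤ p + d) (+-identityʳ p) (+-monoʳ-≤ p 0≤d)

  *-mono : ∀ {p q r s} → 0ℚ ≤ q → 0ℚ ≤ r → p ≤ q → r ≤ s → p * r ≤ q * s
  *-mono {p} {q} {r} {s} 0≤q 0≤r p≤q r≤s = ≤-trans
    (*-monoʳ-≤-nonNeg r {{nonNegative 0≤r}} p≤q)
    (*-monoˡ-≤-nonNeg q {{nonNegative 0≤q}} r≤s)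

  0≤· : ∀ n {p} → 0ℚ ≤ p → 0ℚ ≤ n · p
  0≤· zero    0≤p = ≤-refl
  0≤· (suc n) 0≤p = 0≤p ⊕ 0≤· n 0≤p

  ·-monoˡ : ∀ {m n p} → 0ℚ ≤ p → m ℕ.≤ n → m · p ≤ n · p
  ·-monoˡ {n = n} 0≤p z≤n       = 0≤· n 0≤p
  ·-monoˡ {p = p} 0≤p (s≤s m≤n) = +-monoʳ-≤ p (·-monoˡ 0≤p m≤n)

  -- Bernoulli's inequality for any base from 1 + x upwards; applied to |w|², it makes |w|^2m grow
  -- at least linearly in m.
  bernoulli : ∀ {x y} → 0ℚ ≤ x → 1ℚ + x ≤ y → ∀ n → 1ℚ + n · x ≤ y ^ n
  bernoulli         0≤x 1+x≤y zero    = ≤-refl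
  bernoulli {x} {y} 0≤x 1+x≤y (suc n) = ≤-trans
    (≤-from-gap (x * n · x) (0≤x ⊗ 0≤n·x)
      (solve 2 (λ x t → (con 1ℚ :+ x) :* (con 1ℚ :+ t) := (con 1ℚ :+ (x :+ t)) :+ x :* t)
         refl x (n · x)))
    (*-mono (≤-trans (nonNegative⁻¹ 1ℚ ⊕ 0≤x) 1+x≤y) (nonNegative⁻¹ 1ℚ ⊕ 0≤n·x)
      1+x≤y (bernoulli 0≤x 1+x≤y n))
    where
    0≤n·x = 0≤· n 0≤x

  n·1≃n : ∀ n → toℚᵘ (n · 1ℚ) ℚᵘ.≃ ℚᵘ.mkℚᵘ (ℤ.+ n) 0
  n·1≃n zero    = ℚᵘ.≃-refl
  n·1≃n (suc n) = ℚᵘ.≃-trans (toℚᵘ-homo-+ 1ℚ (n · 1ℚ))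
    (ℚᵘ.≃-trans (ℚᵘ.+-congʳ (toℚᵘ 1ℚ) (n·1≃n n))
      (ℚᵘ.*≡* (cong (λ i → (ℤ.1ℤ ℤ.+ i) ℤ.* ℤ.1ℤ) (ℤ.*-identityʳ (ℤ.+ n)))))

  -- The denominator is at least 1, so the absolute value of the numerator is large enough.
  integer-bound : ∀ p → ∃[ n ] p ≤ n · 1ℚ
  integer-bound p = n , toℚᵘ-cancel-≤
    (ℚᵘ.≤-trans (ℚᵘ.*≤* bound) (ℚᵘ.≤-reflexive (ℚᵘ.≃-sym (n·1≃n n))))
    where
    n = ℤ.∣ ↥ p ∣

    i≤∣i∣ : ∀ i → i ℤ.≤ ℤ.+ ℤ.∣ i ∣
    i≤∣i∣ (ℤ.+ _)      = ℤ.≤-refl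
    i≤∣i∣ (ℤ.-[1+ _ ]) = ℤ.-≤+

    bound : ℚᵘ.↥ (toℚᵘ p) ℤ.* ℤ.1ℤ ℤ.≤ ℤ.+ n ℤ.* ℚᵘ.↧ (toℚᵘ p)
    bound = begin
      ℚᵘ.↥ (toℚᵘ p) ℤ.* ℤ.1ℤ ≡⟨ ℤ.*-identityʳ _ ⟩
      ℚᵘ.↥ (toℚᵘ p)          ≡⟨ ↥ᵘ-toℚᵘ p ⟩
      ↥ p                    ≤⟨ i≤∣i∣ (↥ p) ⟩
      ℤ.+ n                  ≡⟨ ℤ.*-identityʳ _ ⟨
      ℤ.+ n ℤ.* ℤ.1ℤ         ≤⟨ ℤ.*-monoˡ-≤-nonNeg (ℤ.+ n) (ℤ.+≤+ (s≤s z≤n)) ⟩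
      ℤ.+ n ℤ.* ℚᵘ.↧ (toℚᵘ p) ∎
      where open ℤ.≤-Reasoning

  archimedean : ∀ {p} → 0ℚ < p → ∀ q → ∃[ n ] q ≤ n · p
  archimedean {p} 0<p q = n , (begin
    q                ≡⟨ *-identityʳ q ⟨
    q * 1ℚ           ≡⟨ cong (q *_) (*-inverseˡ p) ⟨
    q * (1/ p * p)   ≡⟨ *-assoc q (1/ p) p ⟨
    q * 1/ p * p     ≤⟨ *-monoʳ-≤-nonNeg p {{pos⇒nonNeg p}} q/p≤n ⟩
    n · 1ℚ * p       ≡⟨ Mult.×-assoc-* semiring n 1ℚ p ⟩
    n · (1ℚ * p)     ≡⟨ cong (n ·_) (*-identityˡ p) ⟩
    n · p            ∎)
    where
    open ≤-Reasoning
    semiring = CommutativeRing.semiring +-*-commutativeRing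
    instance
      _ = positive 0<p
      _ = pos⇒nonZero p
    n = proj₁ (integer-bound (q * 1/ p))
    q/p≤n = proj₂ (integer-bound (q * 1/ p))

  -- Squared norms

  2ℚ 3ℚ : ℚ
  2ℚ = 1ℚ + 1ℚ
  3ℚ = 1ℚ + 2ℚ

  normSq : ℚ[i] → ℚ
  normSq (a , b) = a * a + b * b

  0≤normSq : ∀ z → 0ℚ ≤ normSq z
  0≤normSq (a , b) = 0≤p*p a ⊕ 0≤p*p b

  normSq-* : ∀ z w → normSq (z *ᵢ w) ≡ normSq z * normSq w
  normSq-* (a , b) (c , d) = solve 4 (λ a b c d →
    (a :* c :+ :- (b :* d)) :* (a :* c :+ :- (b :* d)) :+ (a :* d :+ b :* c) :* (a :* d :+ b :* c) :=
    (a :* a :+ b :* b) :* (c :* c :+ d :* d)) refl a b c d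

  normSq-^ : ∀ z n → normSq (z ^ᵢ n) ≡ normSq z ^ n
  normSq-^ z zero    = refl
  normSq-^ z (suc n) = trans (normSq-* z (z ^ᵢ n)) (cong (normSq z *_) (normSq-^ z n))

  -- |1 + w|² − 1
  excess : ℚ[i] → ℚ
  excess (a , b) = normSq (a , b) + 2ℚ * a

  normSq-1+ : ∀ w → normSq (1ᵢ +ᵢ w) ≡ 1ℚ + excess w
  normSq-1+ (a , b) = solve 2 (λ a b →
    (con 1ℚ :+ a) :* (con 1ℚ :+ a) :+ (con 0ℚ :+ b) :* (con 0ℚ :+ b) :=
    con 1ℚ :+ (a :* a :+ b :* b :+ con 2ℚ :* a)) refl a b

  -- Factoring out w^m separates the growth in m from the factor |1 + w^k|², which is free of m.
  normSq-sum-of-powers : ∀ w m k →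
    normSq (w ^ᵢ m +ᵢ w ^ᵢ (m ℕ.+ k)) ≡ normSq w ^ m * (1ℚ + excess (w ^ᵢ k))
  normSq-sum-of-powers w m k = begin
    normSq (w ^ᵢ m +ᵢ w ^ᵢ (m ℕ.+ k))
      ≡⟨ cong normSq (cong₂ _+ᵢ_ (sym (*-identityʳᵢ (w ^ᵢ m))) (^ᵢ-homo-*ᵢ w m k)) ⟩
    normSq (w ^ᵢ m *ᵢ 1ᵢ +ᵢ w ^ᵢ m *ᵢ w ^ᵢ k)
      ≡⟨ cong normSq (sym (distribˡᵢ (w ^ᵢ m) 1ᵢ (w ^ᵢ k))) ⟩
    normSq (w ^ᵢ m *ᵢ (1ᵢ +ᵢ w ^ᵢ k))
      ≡⟨ normSq-* (w ^ᵢ m) (1ᵢ +ᵢ w ^ᵢ k) ⟩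
    normSq (w ^ᵢ m) * normSq (1ᵢ +ᵢ w ^ᵢ k)
      ≡⟨ cong₂ _*_ (normSq-^ w m) (normSq-1+ (w ^ᵢ k)) ⟩
    normSq w ^ m * (1ℚ + excess (w ^ᵢ k)) ∎
    where
    open ≡-Reasoning
    open CommutativeSemiring ℚ[i]-commutativeSemiring using ()
      renaming (*-identityʳ to *-identityʳᵢ; distribˡ to distribˡᵢ)

  0≤1 : 0ℚ ≤ 1ℚ
  0≤1 = nonNegative⁻¹ 1ℚ

  1≤⇒0≤ : ∀ {u} → 1ℚ ≤ u → 0ℚ ≤ u
  1≤⇒0≤ = ≤-trans 0≤1

  1≤^ : ∀ {x} → 1ℚ ≤ x → ∀ n → 1ℚ ≤ x ^ n
  1≤^ 1≤x zero    = ≤-refl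
  1≤^ 1≤x (suc n) = *-mono (1≤⇒0≤ 1≤x) 0≤1 1≤x (1≤^ 1≤x n)

  -- Exponents up to 6

  infixr 8 _:^ᵢ_
  -- `_^ᵢ_` transcribed into the solver's syntax, so that identities about a fixed complex power
  -- need no expansion by hand.
  _:^ᵢ_ : ∀ {n} → Polynomial n × Polynomial n → ℕ → Polynomial n × Polynomial n
  _       :^ᵢ zero  = con 1ℚ , con 0ℚ
  (a , b) :^ᵢ suc k = let c , d = (a , b) :^ᵢ k in
    a :* c :+ :- (b :* d) , a :* d :+ b :* c

  :excess : ∀ {n} → Polynomial n × Polynomial n → Polynomial n
  :excess (a , b) = (a :* a :+ b :* b) :+ con 2ℚ :* a

  -- The certificates rewrite (1 + s)^k + 2 Re (1 + iτ)^k, where s = τ².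
  0≤excess-1+iτ : ∀ {k} → k ℕ.≤ 6 → ∀ τ → 0ℚ ≤ excess ((1ℚ , τ) ^ᵢ k)
  0≤excess-1+iτ {0} _ τ = nonNegative⁻¹ _
  0≤excess-1+iτ {1} _ τ = subst (0ℚ ≤_)
    (sym (solve 1 (λ τ → :excess ((con 1ℚ , τ) :^ᵢ 1) := con 3ℚ :+ τ :* τ) refl τ))
    (nonNegative⁻¹ 3ℚ ⊕ 0≤p*p τ)
  0≤excess-1+iτ {2} _ τ = subst (0ℚ ≤_)
    (sym (solve 1 (λ τ → let s = τ :* τ in
       :excess ((con 1ℚ , τ) :^ᵢ 2) := con 3ℚ :+ s :* s) refl τ))
    (nonNegative⁻¹ 3ℚ ⊕ 0≤p*p (τ * τ))
  0≤excess-1+iτ {3} _ τ = subst (0ℚ ≤_)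
    (sym (solve 1 (λ τ → let s = τ :* τ; d = s :- con ½ in
       :excess ((con 1ℚ , τ) :^ᵢ 3) :=
         con 3ℚ :* (d :* d) :+ con (+ 9 / 4) :+ s :* (s :* s)) refl τ))
    (nonNegative⁻¹ 3ℚ ⊗ 0≤p*p (τ * τ - ½) ⊕ nonNegative⁻¹ (+ 9 / 4) ⊕ 0≤p*p τ ⊗ 0≤p*p (τ * τ))
  0≤excess-1+iτ {4} _ τ = subst (0ℚ ≤_)
    (sym (solve 1 (λ τ → let s = τ :* τ; d = s :- con ½ in
       :excess ((con 1ℚ , τ) :^ᵢ 4) :=
         con (+ 8 / 1) :* (d :* d) :+ con 1ℚ :+ s :* (s :* s) :* (con (+ 4 / 1) :+ s)) refl τ))
    (nonNegative⁻¹ (+ 8 / 1) ⊗ 0≤p*p (τ * τ - ½) ⊕ nonNegative⁻¹ 1ℚ ⊕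
      0≤p*p τ ⊗ 0≤p*p (τ * τ) ⊗ (nonNegative⁻¹ (+ 4 / 1) ⊕ 0≤p*p τ))
  0≤excess-1+iτ {5} _ τ = subst (0ℚ ≤_)
    (sym (solve 1 (λ τ → let s = τ :* τ; d = s :- con (+ 3 / 8) in
       :excess ((con 1ℚ , τ) :^ᵢ 5) :=
         con (+ 20 / 1) :* (d :* d) :+ con (+ 3 / 16) :+
         s :* (s :* s) :* (con (+ 10 / 1) :+ con (+ 5 / 1) :* s :+ s :* s)) refl τ))
    (nonNegative⁻¹ (+ 20 / 1) ⊗ 0≤p*p (τ * τ - + 3 / 8) ⊕ nonNegative⁻¹ (+ 3 / 16) ⊕
      0≤p*p τ ⊗ 0≤p*p (τ * τ) ⊗
        (nonNegative⁻¹ (+ 10 / 1) ⊕ nonNegative⁻¹ (+ 5 / 1) ⊗ 0≤p*p τ ⊕ 0≤p*p (τ * τ)))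
  0≤excess-1+iτ {6} _ τ = subst (0ℚ ≤_)
    -- For exponents 3 to 5, completing the square in the part of degree at most 2 in s was enough.
    -- Here that part, 3 - 24 s + 45 s², is negative for 1/5 < s < 1/3, so the term 18 s³ is spent
    -- as well, through `2 s (3 s − 1)²`.
    (sym (solve 1 (λ τ →
       let s = τ :* τ; d = con 3ℚ :- con (+ 13 / 1) :* s; e = con 3ℚ :* s :- con 1ℚ in
       :excess ((con 1ℚ , τ) :^ᵢ 6) :=
         con (+ 1 / 3) :* (d :* d) :+ con (+ 2 / 3) :* (s :* s) :+ con 2ℚ :* s :* (e :* e) :+
         (s :* s) :* (s :* s) :* (con (+ 15 / 1) :+ con (+ 6 / 1) :* s :+ s :* s)) refl τ))
    (nonNegative⁻¹ (+ 1 / 3) ⊗ 0≤p*p (3ℚ - + 13 / 1 * (τ * τ)) ⊕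
      nonNegative⁻¹ (+ 2 / 3) ⊗ 0≤p*p (τ * τ) ⊕
      nonNegative⁻¹ 2ℚ ⊗ 0≤p*p τ ⊗ 0≤p*p (3ℚ * (τ * τ) - 1ℚ) ⊕
      0≤p*p (τ * τ) ⊗ 0≤p*p (τ * τ) ⊗
        (nonNegative⁻¹ (+ 15 / 1) ⊕ nonNegative⁻¹ (+ 6 / 1) ⊗ 0≤p*p τ ⊕ 0≤p*p (τ * τ)))
  0≤excess-1+iτ {suc (suc (suc (suc (suc (suc (suc k))))))} (s≤s (s≤s (s≤s (s≤s (s≤s (s≤s ())))))) τ

  real-^ : ∀ u k → (u , 0ℚ) ^ᵢ k ≡ (u ^ k , 0ℚ)
  real-^ u zero    = refl
  real-^ u (suc k) = trans (cong ((u , 0ℚ) *ᵢ_) (real-^ u k)) (cong₂ _,_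
    (solve 2 (λ u x → u :* x :+ :- (con 0ℚ :* con 0ℚ) := u :* x) refl u (u ^ k))
    (solve 2 (λ u x → u :* con 0ℚ :+ con 0ℚ :* x := con 0ℚ) refl u (u ^ k)))

  -- For real x, the excess of x w equals x ((x - 1) |w|² + excess w).
  excess-scale : ∀ {x} → 1ℚ ≤ x → ∀ w → 0ℚ ≤ excess w → 0ℚ ≤ excess ((x , 0ℚ) *ᵢ w)
  excess-scale {x} 1≤x (a , b) 0≤e = subst (0ℚ ≤_)
    (sym (solve 3 (λ x a b →
       let c = x :* a :+ :- (con 0ℚ :* b)
           d = x :* b :+ con 0ℚ :* a in
       (c :* c :+ d :* d) :+ con 2ℚ :* c :=
       x :* ((x :- con 1ℚ) :* (a :* a :+ b :* b) :+ ((a :* a :+ b :* b) :+ con 2ℚ :* a)))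
       refl x a b))
    (1≤⇒0≤ 1≤x ⊗ (p≤q⇒0≤q-p 1≤x ⊗ 0≤normSq (a , b) ⊕ 0≤e))

  0≤excess-k≤6 : ∀ {k} → k ℕ.≤ 6 → ∀ {u} v → 1ℚ ≤ u → 0ℚ ≤ excess ((u , v) ^ᵢ k)
  0≤excess-k≤6 {k} k≤6 {u} v 1≤u = subst (λ w → 0ℚ ≤ excess w) (sym factor)
    (excess-scale (1≤^ 1≤u k) ((1ℚ , τ) ^ᵢ k) (0≤excess-1+iτ k≤6 τ))
    where
    open ≡-Reasoning
    instance
      _ = pos⇒nonZero u {{positive (<-≤-trans (positive⁻¹ 1ℚ) 1≤u)}}
    τ = 1/ u * v

    uτ≡v : u * τ ≡ v
    uτ≡v = trans (sym (*-assoc u (1/ u) v)) (trans (cong (_* v) (*-inverseʳ u)) (*-identityˡ v))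

    factor : (u , v) ^ᵢ k ≡ (u ^ k , 0ℚ) *ᵢ (1ℚ , τ) ^ᵢ k
    factor = begin
      (u , v) ^ᵢ k
        ≡⟨ cong (_^ᵢ k) (cong₂ _,_
             (solve 2 (λ u t → u := u :* con 1ℚ :+ :- (con 0ℚ :* t)) refl u τ)
             (trans (sym uτ≡v) (solve 2 (λ u t → u :* t := u :* t :+ con 0ℚ :* con 1ℚ) refl u τ))) ⟩
      ((u , 0ℚ) *ᵢ (1ℚ , τ)) ^ᵢ k
        ≡⟨ ^ᵢ-distrib-*ᵢ (u , 0ℚ) (1ℚ , τ) k ⟩
      (u , 0ℚ) ^ᵢ k *ᵢ (1ℚ , τ) ^ᵢ k
        ≡⟨ cong (_*ᵢ (1ℚ , τ) ^ᵢ k) (real-^ u k) ⟩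
      (u ^ k , 0ℚ) *ᵢ (1ℚ , τ) ^ᵢ k ∎

  -- Powers near and far from the real axis

  p≤∣p∣ : ∀ p → p ≤ ∣ p ∣
  p≤∣p∣ p with ≤-total 0ℚ p
  ... | inj₁ 0≤p = ≤-reflexive (sym (0≤p⇒∣p∣≡p 0≤p))
  ... | inj₂ p≤0 = ≤-trans p≤0 (0≤∣p∣ p)

  ∣p*q∣≤ : ∀ {p q x y} → ∣ p ∣ ≤ x → ∣ q ∣ ≤ y → ∣ p * q ∣ ≤ x * y
  ∣p*q∣≤ {p} {q} p≤x q≤y = subst (_≤ _) (sym (∣p*q∣≡∣p∣*∣q∣ p q))
    (*-mono (≤-trans (0≤∣p∣ p) p≤x) (0≤∣p∣ q) p≤x q≤y)

  -- Multiplying by u + iv adds a small angle. The new slope is at most h (u + 1) / (u - h²) ≤ 2h /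
  -- (1 - h²), which is below 4h for h ≤ 1/4.
  widen-sector : ∀ {h u v a b} → 0ℚ ≤ h → + 4 / 1 * h ≤ 1ℚ → 1ℚ ≤ u → ∣ v ∣ ≤ h →
    0ℚ ≤ a → ∣ b ∣ ≤ h * a →
    0ℚ ≤ u * a + - (v * b) × ∣ u * b + v * a ∣ ≤ + 4 / 1 * h * (u * a + - (v * b))
  widen-sector {h} {u} {v} {a} {b} 0≤h 4h≤1 1≤u v≤h 0≤a b≤ha =
    ≤-trans 0≤ℓ ℓ≤re , (begin
      ∣ u * b + v * a ∣
        ≤⟨ ∣p+q∣≤∣p∣+∣q∣ (u * b) (v * a) ⟩
      ∣ u * b ∣ + ∣ v * a ∣
        ≤⟨ +-mono-≤
             (∣p*q∣≤ {u} {b} (≤-reflexive (0≤p⇒∣p∣≡p (1≤⇒0≤ 1≤u))) b≤ha)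
             (∣p*q∣≤ {v} {a} v≤h (≤-reflexive (0≤p⇒∣p∣≡p 0≤a))) ⟩
      u * (h * a) + h * a
        ≤⟨ ≤-from-gap (h * a * (3ℚ * d + 1ℚ + m)) (0≤h ⊗ 0≤a ⊗ (nonNegative⁻¹ 3ℚ ⊗ 0≤d ⊕ 0≤1 ⊕ 0≤m))
             (solve 3 (λ h u a →
               let d = u :- con 1ℚ
                   g = con 1ℚ :- con (+ 4 / 1) :* h in
               con (+ 4 / 1) :* h :* (u :* a :- h :* (h :* a)) :=
               u :* (h :* a) :+ h :* a :+
                 h :* a :* (con 3ℚ :* d :+ con 1ℚ :+ (g :+ con 3ℚ :* h :+ h :* g)))
               refl h u a) ⟩
      + 4 / 1 * h * ℓ
        ≤⟨ *-mono (nonNegative⁻¹ (+ 4 / 1) ⊗ 0≤h) 0≤ℓ ≤-refl ℓ≤re ⟩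
      + 4 / 1 * h * (u * a + - (v * b)) ∎)
    where
    open ≤-Reasoning
    -- `ℓ` is the least real part compatible with |v| ≤ h and |b| ≤ h a.
    ℓ = u * a - h * (h * a)
    d = u - 1ℚ
    g = 1ℚ - + 4 / 1 * h
    -- This is 1 - 4h², written as a sum of nonnegative terms.
    m = g + 3ℚ * h + h * g

    0≤d : 0ℚ ≤ d
    0≤d = p≤q⇒0≤q-p 1≤u

    0≤m : 0ℚ ≤ m
    0≤m = p≤q⇒0≤q-p 4h≤1 ⊕ nonNegative⁻¹ 3ℚ ⊗ 0≤h ⊕ 0≤h ⊗ p≤q⇒0≤q-p 4h≤1

    0≤ℓ : 0ℚ ≤ ℓ
    0≤ℓ = subst (0ℚ ≤_)
      (solve 3 (λ h u a →
        let d = u :- con 1ℚ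
            g = con 1ℚ :- con (+ 4 / 1) :* h in
        a :* (d :+ (g :+ con 3ℚ :* h :+ h :* g) :+ con 3ℚ :* (h :* h)) :=
        u :* a :- h :* (h :* a)) refl h u a)
      (0≤a ⊗ (0≤d ⊕ 0≤m ⊕ nonNegative⁻¹ 3ℚ ⊗ 0≤p*p h))

    ℓ≤re : ℓ ≤ u * a + - (v * b)
    ℓ≤re = +-monoʳ-≤ (u * a) (neg-antimono-≤
      (≤-trans (p≤∣p∣ (v * b)) (∣p*q∣≤ {v} {b} v≤h b≤ha)))

  -- Each multiplication widens the sector fourfold at most, so the induction asks for slope c / 4
  -- one power earlier; this is why c is kept general. The resulting η is c / 4^k.
  near-real-axis : ∀ k {c} → 0ℚ < c → c ≤ 1ℚ → ∃[ η ] 0ℚ < η × η ≤ c ×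
    (∀ {u v} → 1ℚ ≤ u → ∣ v ∣ ≤ η →
      let a , b = (u , v) ^ᵢ k in 0ℚ ≤ a × ∣ b ∣ ≤ c * a)
  near-real-axis zero    {c} 0<c c≤1 = c , 0<c , ≤-refl , λ _ _ →
    0≤1 , subst (0ℚ ≤_) (sym (*-identityʳ c)) (<⇒≤ 0<c)
  near-real-axis (suc k) {c} 0<c c≤1 =
    let h = + 1 / 4 * c
        0<h = 0<* (positive⁻¹ (+ 1 / 4)) 0<c
        4h≡c = solve 1 (λ c → con (+ 4 / 1) :* (con (+ 1 / 4) :* c) := c) refl c
        h≤c = ≤-from-gap (+ 3 / 4 * c) (nonNegative⁻¹ (+ 3 / 4) ⊗ <⇒≤ 0<c)
          (solve 1 (λ c → c := con (+ 1 / 4) :* c :+ con (+ 3 / 4) :* c) refl c)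
        η , 0<η , η≤h , cone = near-real-axis k 0<h (≤-trans h≤c c≤1)
    in η , 0<η , ≤-trans η≤h h≤c , λ {u} {v} 1≤u v≤η →
      let 0≤a , b≤ha = cone 1≤u v≤η
          0≤a′ , b′≤ = widen-sector (<⇒≤ 0<h) (≤-trans (≤-reflexive 4h≡c) c≤1) 1≤u
            (≤-trans v≤η η≤h) 0≤a b≤ha
      in 0≤a′ , subst (λ x → _ ≤ x * _) 4h≡c b′≤

  -- With R = |w|², the bound on 1 + excess w is (R − 1)² / 2(R + 1), a form of |1 + w| ≥ |w| − 1
  -- free of square roots.
  1+excess-far : ∀ {δ} → 0ℚ ≤ δ → δ ≤ 1ℚ → ∀ w → 1ℚ + δ ≤ normSq w →
    δ * δ ≤ + 6 / 1 * (1ℚ + excess w)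
  1+excess-far {δ} 0≤δ δ≤1 (x , y) 1+δ≤R = *-cancelˡ-≤-pos (R + 1ℚ) {{positive 0<R+1}} (begin
    (R + 1ℚ) * (δ * δ)
      ≤⟨ ≤-from-gap ((R + 1ℚ) * δ * e) ((0≤R ⊕ 0≤1) ⊗ 0≤δ ⊗ 0≤e)
           (solve 2 (λ R δ →
             δ :* (R :+ con 1ℚ) :* (R :- con 1ℚ) :=
             (R :+ con 1ℚ) :* (δ :* δ) :+ (R :+ con 1ℚ) :* δ :* (R :- (con 1ℚ :+ δ))) refl R δ) ⟩
    δ * (R + 1ℚ) * (R - 1ℚ)
      -- This is δ (R + 1) ≤ 3 (R - 1), multiplied by R - 1 = δ + e. At R = 1 + δ it reads δ (2 + δ)
      -- ≤ 3δ, hence the need for δ ≤ 1.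
      ≤⟨ ≤-from-gap ((δ * f + 2ℚ * e + e * f) * (δ + e))
           ((0≤δ ⊗ 0≤f ⊕ nonNegative⁻¹ 2ℚ ⊗ 0≤e ⊕ 0≤e ⊗ 0≤f) ⊗ (0≤δ ⊕ 0≤e))
           (solve 2 (λ R δ →
             let e = R :- (con 1ℚ :+ δ)
                 f = con 1ℚ :- δ in
             con 3ℚ :* (R :- con 1ℚ) :* (R :- con 1ℚ) :=
             δ :* (R :+ con 1ℚ) :* (R :- con 1ℚ) :+
               (δ :* f :+ con 2ℚ :* e :+ e :* f) :* (δ :+ e)) refl R δ) ⟩
    3ℚ * (R - 1ℚ) * (R - 1ℚ)
      -- With t = |1 + w|² = R + 1 + 2x, the identity is 2 (R + 1) t = (R - 1)² + t² + 4y²,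
      -- multiplied by 3.
      ≤⟨ ≤-from-gap (3ℚ * ((R + 1ℚ + 2ℚ * x) * (R + 1ℚ + 2ℚ * x)) + + 12 / 1 * (y * y))
           (nonNegative⁻¹ 3ℚ ⊗ 0≤p*p (R + 1ℚ + 2ℚ * x) ⊕ nonNegative⁻¹ (+ 12 / 1) ⊗ 0≤p*p y)
           (solve 2 (λ x y →
             let R = x :* x :+ y :* y
                 t = R :+ con 1ℚ :+ con 2ℚ :* x in
             (R :+ con 1ℚ) :* (con (+ 6 / 1) :* (con 1ℚ :+ (R :+ con 2ℚ :* x))) :=
             con 3ℚ :* (R :- con 1ℚ) :* (R :- con 1ℚ) :+
               (con 3ℚ :* (t :* t) :+ con (+ 12 / 1) :* (y :* y))) refl x y) ⟩
    (R + 1ℚ) * (+ 6 / 1 * (1ℚ + excess (x , y))) ∎)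
    where
    open ≤-Reasoning
    R = normSq (x , y)
    e = R - (1ℚ + δ)
    f = 1ℚ - δ

    0≤e : 0ℚ ≤ e
    0≤e = p≤q⇒0≤q-p 1+δ≤R

    0≤f : 0ℚ ≤ f
    0≤f = p≤q⇒0≤q-p δ≤1

    0≤R : 0ℚ ≤ R
    0≤R = 0≤normSq (x , y)

    0<R+1 : 0ℚ < R + 1ℚ
    0<R+1 = +-mono-≤-< 0≤R (positive⁻¹ 1ℚ)

  -- Lower bounds for |w^m + w^(m+k)|²

  -- Here u + iv stands for w = 1 + z. The same ε appears in hypothesis and conclusion, so that a
  -- gap remains when i(z) is only approximately 0. The cap ε ≤ 1 lets the constant bound 2 suffice
  -- far from the real axis.
  NormSqBound : ℕ → ℕ → Set
  NormSqBound m k = ∀ {ε} → 0ℚ ≤ ε → ε ≤ 1ℚ → ∀ {u} v → 1ℚ + ε ≤ u →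
    1ℚ + ε ≤ normSq ((u , v) ^ᵢ m +ᵢ (u , v) ^ᵢ (m ℕ.+ k))

  normSq-lower : ∀ {ε} → 0ℚ ≤ ε → ∀ {u} v → 1ℚ + ε ≤ u → 1ℚ + ε ≤ normSq (u , v)
  normSq-lower {ε} 0≤ε {u} v 1+ε≤u = ≤-from-gap
    (ε + ε * ε + 2ℚ * (d * (1ℚ + ε)) + d * d + v * v)
    (0≤ε ⊕ 0≤p*p ε ⊕ nonNegative⁻¹ 2ℚ ⊗ (p≤q⇒0≤q-p 1+ε≤u ⊗ (0≤1 ⊕ 0≤ε)) ⊕ 0≤p*p d ⊕ 0≤p*p v)
    (solve 3 (λ ε u v →
      let d = u :- (con 1ℚ :+ ε) in
      u :* u :+ v :* v := con 1ℚ :+ ε :+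
        (ε :+ ε :* ε :+ con 2ℚ :* (d :* (con 1ℚ :+ ε)) :+ d :* d :+ v :* v)) refl ε u v)
    where
    d = u - (1ℚ + ε)

  1+x≤1+n·x : ∀ {x} n → 0ℚ ≤ x → 1 ℕ.≤ n → 1ℚ + x ≤ 1ℚ + n · x
  1+x≤1+n·x {x} n 0≤x 1≤n = +-monoʳ-≤ 1ℚ
    (subst (_≤ n · x) (+-identityʳ x) (·-monoˡ 0≤x 1≤n))

  1≤1+p : ∀ {p} → 0ℚ ≤ p → 1ℚ ≤ 1ℚ + p
  1≤1+p {p} 0≤p = ≤-from-gap p 0≤p refl

  -- The factor |1 + w^k|² is at least 1, so the whole gap ε comes from |w|^2m; this takes m ≥ 1.
  bound-from-excess : ∀ m k → 1 ℕ.≤ m → ∀ {ε} → 0ℚ ≤ ε → ∀ {u} v → 1ℚ + ε ≤ u →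
    0ℚ ≤ excess ((u , v) ^ᵢ k) →
    1ℚ + ε ≤ normSq ((u , v) ^ᵢ m +ᵢ (u , v) ^ᵢ (m ℕ.+ k))
  bound-from-excess m k 1≤m {ε} 0≤ε {u} v 1+ε≤u 0≤e = begin
    1ℚ + ε
      ≡⟨ *-identityʳ (1ℚ + ε) ⟨
    (1ℚ + ε) * 1ℚ
      ≤⟨ *-mono (≤-trans (0≤1 ⊕ 0≤ε) 1+ε≤M) 0≤1 1+ε≤M (1≤1+p 0≤e) ⟩
    normSq (u , v) ^ m * (1ℚ + excess ((u , v) ^ᵢ k))
      ≡⟨ normSq-sum-of-powers (u , v) m k ⟨
    normSq ((u , v) ^ᵢ m +ᵢ (u , v) ^ᵢ (m ℕ.+ k)) ∎
    where
    open ≤-Reasoning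
    1+ε≤M : 1ℚ + ε ≤ normSq (u , v) ^ m
    1+ε≤M = ≤-trans (1+x≤1+n·x m 0≤ε 1≤m) (bernoulli 0≤ε (normSq-lower 0≤ε v 1+ε≤u) m)

  bound-k≤6 : ∀ m {k} → k ℕ.≤ 6 → 1 ℕ.≤ m → NormSqBound m k
  bound-k≤6 m {k} k≤6 1≤m 0≤ε _ v 1+ε≤u = bound-from-excess m k 1≤m 0≤ε v 1+ε≤u
    (0≤excess-k≤6 k≤6 v (≤-trans (1≤1+p 0≤ε) 1+ε≤u))

  -- Bernoulli gives |w|^2m ≥ m δ, and `1+excess-far` at w^k gives |1 + w^k|² ≥ δ² / 6. Their
  -- product reaches 2 once m δ³ ≥ 12.
  bound-far : ∀ m k {δ} → 0ℚ ≤ δ → δ ≤ 1ℚ → 1 ℕ.≤ k → + 12 / 1 ≤ m · (δ * (δ * δ)) →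
    ∀ w → 1ℚ + δ ≤ normSq w → 2ℚ ≤ normSq (w ^ᵢ m +ᵢ w ^ᵢ (m ℕ.+ k))
  bound-far m k {δ} 0≤δ δ≤1 1≤k 12≤mδ³ w 1+δ≤∣w∣² = *-cancelˡ-≤-pos (+ 6 / 1) (begin
    + 6 / 1 * 2ℚ
      ≤⟨ 12≤mδ³ ⟩
    m · (δ * (δ * δ))
      ≡⟨ Mult.×-assoc-* (CommutativeRing.semiring +-*-commutativeRing) m δ (δ * δ) ⟨
    m · δ * (δ * δ)
      ≤⟨ *-mono (≤-trans (0≤· m 0≤δ) mδ≤M) (0≤p*p δ) mδ≤M (1+excess-far 0≤δ δ≤1 (w ^ᵢ k) 1+δ≤∣wᵏ∣²) ⟩
    normSq w ^ m * (+ 6 / 1 * (1ℚ + excess (w ^ᵢ k)))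
      ≡⟨ solve 2 (λ M S → M :* (con (+ 6 / 1) :* S) := con (+ 6 / 1) :* (M :* S)) refl
           (normSq w ^ m) (1ℚ + excess (w ^ᵢ k)) ⟩
    + 6 / 1 * (normSq w ^ m * (1ℚ + excess (w ^ᵢ k)))
      ≡⟨ cong (+ 6 / 1 *_) (normSq-sum-of-powers w m k) ⟨
    + 6 / 1 * normSq (w ^ᵢ m +ᵢ w ^ᵢ (m ℕ.+ k)) ∎)
    where
    open ≤-Reasoning
    mδ≤M : m · δ ≤ normSq w ^ m
    mδ≤M = ≤-trans (≤-from-gap 1ℚ 0≤1 (+-comm 1ℚ (m · δ))) (bernoulli 0≤δ 1+δ≤∣w∣² m)

    1+δ≤∣wᵏ∣² : 1ℚ + δ ≤ normSq (w ^ᵢ k)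
    1+δ≤∣wᵏ∣² = subst (1ℚ + δ ≤_) (sym (normSq-^ w k))
      (≤-trans (1+x≤1+n·x k 0≤δ 1≤k) (bernoulli 0≤δ 1+δ≤∣w∣² k))

  bound-large-m : ∀ k → 1 ℕ.≤ k → ∃[ N ] (∀ m → N ℕ.< m → NormSqBound m k)
  bound-large-m k 1≤k =
    -- Only the sign of Re w^k matters here, so the largest admissible slope, 1, is chosen.
    let η , 0<η , η≤1 , near = near-real-axis k (positive⁻¹ 1ℚ) ≤-refl
        δ = η * η
        0≤δ = 0≤p*p η
        0<δ = 0<* 0<η 0<η
        δ≤1 = *-mono 0≤1 (<⇒≤ 0<η) η≤1 η≤1
        N , 12≤Nδ³ = archimedean (0<* 0<δ (0<* 0<δ 0<δ)) (+ 12 / 1)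
    in N , λ m N<m 0≤ε ε≤1 {u} v 1+ε≤u →
      let 1≤u = ≤-trans (1≤1+p 0≤ε) 1+ε≤u in
      case ≤-total ∣ v ∣ η of λ where
        (inj₁ v≤η) → bound-from-excess m k (ℕ.≤-trans (s≤s z≤n) N<m) 0≤ε v 1+ε≤u
          (0≤normSq ((u , v) ^ᵢ k) ⊕ nonNegative⁻¹ 2ℚ ⊗ proj₁ (near 1≤u v≤η))
        (inj₂ η≤v) → ≤-trans (+-monoʳ-≤ 1ℚ ε≤1)
          (bound-far m k 0≤δ δ≤1 1≤k
            (≤-trans 12≤Nδ³ (·-monoˡ (0≤δ ⊗ (0≤δ ⊗ 0≤δ)) (ℕ.<⇒≤ N<m)))
            (u , v)
            -- u² ≥ 1 and v² ≥ η² = δ.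
            (+-mono-≤ (*-mono (1≤⇒0≤ 1≤u) 0≤1 1≤u 1≤u)
              (≤-trans (*-mono (0≤∣p∣ v) (<⇒≤ 0<η) η≤v η≤v)
                (≤-reflexive (sym (p*p≡∣p∣*∣p∣ v))))))

  -- From rational approximations to roots

  -- Since |a| and |b| are at most 1, squares are bounded by absolute values, and a² + 2a + b² ≤
  -- 3|a| + |b| is below four quarters of ε.
  normSq-near-1 : ∀ {ε a b} → ε ≤ 1ℚ → ∣ a ∣ < + 1 / 4 * ε → ∣ b ∣ < + 1 / 4 * ε →
    normSq ((a , b) +ᵢ 1ᵢ) < 1ℚ + ε
  normSq-near-1 {ε} {a} {b} ε≤1 a<η b<η = begin-strict
    normSq ((a , b) +ᵢ 1ᵢ)
      ≡⟨ solve 2 (λ a b →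
           (a :+ con 1ℚ) :* (a :+ con 1ℚ) :+ (b :+ con 0ℚ) :* (b :+ con 0ℚ) :=
           con 1ℚ :+ ((a :* a :+ con 2ℚ :* a) :+ b :* b)) refl a b ⟩
    1ℚ + ((a * a + 2ℚ * a) + b * b)
      ≤⟨ +-monoʳ-≤ 1ℚ (+-mono-≤ (+-mono-≤ (square a a<η) (*-monoˡ-≤-nonNeg 2ℚ (p≤∣p∣ a))) (square b b<η)) ⟩
    1ℚ + ((∣ a ∣ + 2ℚ * ∣ a ∣) + ∣ b ∣)
      <⟨ +-monoʳ-< 1ℚ (+-mono-< (+-mono-< a<η (*-monoʳ-<-pos 2ℚ a<η)) b<η) ⟩
    1ℚ + ((+ 1 / 4 * ε + 2ℚ * (+ 1 / 4 * ε)) + + 1 / 4 * ε)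
      ≡⟨ solve 1 (λ ε → let η = con (+ 1 / 4) :* ε in
           con 1ℚ :+ ((η :+ con 2ℚ :* η) :+ η) := con 1ℚ :+ ε) refl ε ⟩
    1ℚ + ε ∎
    where
    open ≤-Reasoning
    square : ∀ p → ∣ p ∣ < + 1 / 4 * ε → p * p ≤ ∣ p ∣
    square p p<η = begin
      p * p         ≡⟨ p*p≡∣p∣*∣p∣ p ⟩
      ∣ p ∣ * ∣ p ∣ ≤⟨ *-monoʳ-≤-nonNeg ∣ p ∣ {{nonNegative (0≤∣p∣ p)}} p≤1 ⟩
      1ℚ * ∣ p ∣    ≡⟨ *-identityˡ ∣ p ∣ ⟩
      ∣ p ∣         ∎
      where
      p≤1 : ∣ p ∣ ≤ 1ℚ
      p≤1 = ≤-trans (<⇒≤ p<η) (≤-trans (*-monoˡ-≤-nonNeg (+ 1 / 4) ε≤1) (≤ᵇ⇒≤ _))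

  at-independencePolynomial-K : ∀ n a b z →
    at n (independencePolynomial (K a b) z) +ᵢ 1ᵢ ≡ (1ᵢ +ᵢ at n z) ^ᵢ a +ᵢ (1ᵢ +ᵢ at n z) ^ᵢ b
  at-independencePolynomial-K n a b z = trans
    (cong (_+ᵢ 1ᵢ) (at-independencePolynomial n (K a b) z)) (polynomial-K (at n z) a b)

  ≈0⇒normSq-near-1 : ∀ p → p ≈ᶜ 0ᶜ → ∀ {ε} → 0ℚ < ε → ε ≤ 1ℚ →
    ∃[ N ] (∀ n → N ℕ.≤ n → normSq (at n p +ᵢ 1ᵢ) < 1ℚ + ε)
  ≈0⇒normSq-near-1 p (Re≈0 , Im≈0) {ε} 0<ε ε≤1 =
    let 0<η = 0<* (positive⁻¹ (+ 1 / 4)) 0<ε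
        M , small-Re = Re≈0 (+ 1 / 4 * ε) 0<η
        N , small-Im = Im≈0 (+ 1 / 4 * ε) 0<η
    in M ℕ.⊔ N , λ n ≤n → normSq-near-1 ε≤1
         (drop-0 (approx (Re p) n) (small-Re n (ℕ.≤-trans (ℕ.m≤m⊔n M N) ≤n)))
         (drop-0 (approx (Im p) n) (small-Im n (ℕ.≤-trans (ℕ.m≤n⊔m M N) ≤n)))
    where
    drop-0 : ∀ x → ∣ x - 0ℚ ∣ < + 1 / 4 * ε → ∣ x ∣ < + 1 / 4 * ε
    drop-0 x = subst (λ y → ∣ y ∣ < + 1 / 4 * ε) (+-identityʳ x)

  normSq-polynomial : ∀ m k → NormSqBound m k → ∀ {ε} → 0ℚ ≤ ε → ε ≤ 1ℚ →
    ∀ z n → ε ≤ approx (Re z) n →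
    1ℚ + ε ≤ normSq (at n (independencePolynomial (K m (m ℕ.+ k)) z) +ᵢ 1ᵢ)
  normSq-polynomial m k bound {ε} 0≤ε ε≤1 z n ε≤Re = subst (λ q → 1ℚ + ε ≤ normSq q)
    (sym (at-independencePolynomial-K n m (m ℕ.+ k) z))
    -- The coordinates are those of `1ᵢ +ᵢ at n z` as they reduce, hence the explicit `0ℚ +`.
    (bound 0≤ε ε≤1 {1ℚ + approx (Re z) n} (0ℚ + approx (Im z) n) (+-monoʳ-≤ 1ℚ ε≤Re))

  positive-below-1 : ∀ {p} → 0ℚ < p → ∃[ ε ] 0ℚ < ε × ε ≤ p × ε ≤ 1ℚ
  positive-below-1 {p} 0<p with ≤-total p 1ℚ
  ... | inj₁ p≤1 = p , 0<p , ≤-refl , p≤1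
  ... | inj₂ 1≤p = 1ℚ , positive⁻¹ 1ℚ , 1≤p , ≤-refl

  -- `Re z ≤ᴿ 0ᴿ` unfolds to a refutation of `0ᴿ <ᴿ Re z`, whose witness bounds Re z below at all
  -- late indices. One index past both thresholds already gives the contradiction.
  root-Re≤0 : ∀ p z →
    (∀ {ε} → 0ℚ ≤ ε → ε ≤ 1ℚ → ∀ n → ε ≤ approx (Re z) n → 1ℚ + ε ≤ normSq (at n p +ᵢ 1ᵢ)) →
    p ≈ᶜ 0ᶜ → Re z ≤ᴿ 0ᴿ
  root-Re≤0 p z bound p≈0 (ε₀ , 0<ε₀ , M , ε₀≤Re) =
    let ε , 0<ε , ε≤ε₀ , ε≤1 = positive-below-1 0<ε₀
        N , near-1 = ≈0⇒normSq-near-1 p p≈0 0<ε ε≤1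
        n = M ℕ.⊔ N
        ε≤Re = ≤-trans ε≤ε₀
          (subst (_≤ approx (Re z) n) (+-identityˡ ε₀) (ε₀≤Re n (ℕ.m≤m⊔n M N)))
    in <-irrefl refl
         (<-≤-trans (near-1 n (ℕ.m≤n⊔m M N)) (bound (<⇒≤ 0<ε) ε≤1 n ε≤Re))

  stable : ∀ m k → NormSqBound m k → Stable (K m (m ℕ.+ k))
  stable m k bound z = root-Re≤0 (independencePolynomial (K m (m ℕ.+ k)) z) z
    λ 0≤ε ε≤1 → normSq-polynomial m k bound 0≤ε ε≤1 z

open Estimates using (stable; bound-k≤6; bound-large-m)
open import Data.Nat.Base using (_+_; _≤_; _≥_; _>_)

theorem3 : (k : ℕ) →
    (k ≤ 6 → ∀ (m : ℕ) → m ≥ 1 → Stable (K m (m + k))) ×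
    (k ≥ 7 → ∃[ N ] (∀ (m : ℕ) → m > N → Stable (K m (m + k))))
theorem3 k =
  (λ k≤6 m 1≤m → stable m k (bound-k≤6 m k≤6 1≤m)) ,
  (λ 7≤k → let N , bound = bound-large-m k (ℕ.≤-trans (s≤s z≤n) 7≤k)
           in N , λ m N<m → stable m k (bound m N<m))
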